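{- Let $q=3^d$ with $d$ odd. Let $E\colon y^2=x^3+a_4x+a_6$ be an elliptic curve over $\mathbb{F}_q$ of Type $\mathrm{I}^+$, i.e. such that $a_4\in\mathbb{F}_q^\times$ is a fourth power in $\mathbb{F}_q^\times$. Then $E$ is isomorphic over $\mathbb{F}_q$ to the curve $y^2=x^3+x$. In particular all Type $\mathrm{I}^+$ curves over $\mathbb{F}_q$ are isomorphic over $\mathbb{F}_q$.
   Context: In characteristic $3$, every supersingular elliptic curve over $\mathbb{F}_q$ can be written as $y^2=x^3+a_4x+a_6$ with $a_4\neq0$. -}

module Defs where

open import Level using (Level; _⊔_; suc)
open import Algebra.Apartness.Bundles using (HeytingField; HeytingCommutativeRing)
open import Algebra.Bundles using (CommutativeRing; Semiring)
open import Algebra.Morphism.Structures using (module RingMorphisms)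
open import Data.Fin.Base using (Fin)
open import Data.Fin.Patterns using (0F; 1F; 2F)
open import Data.List.Base using (List; foldr)
open import Data.Nat.Base as ℕ using (ℕ)
open import Data.Product.Base using (∃; _×_; _,_; proj₁; proj₂)
open import Function.Bundles using (Inverse)
open import Relation.Binary.PropositionalEquality.Core using (_≡_)
open import Relation.Binary.PropositionalEquality.Properties using (setoid)
import Algebra.Definitions.RawMonoid as RawMonoidDefs
import Algebra.Definitions.RawSemiring as RawSemiringDefs
import Relation.Binary.Reasoning.Setoid as SetoidReasoning

private
  variable
    c ℓ₁ ℓ₂ : Level

module Field (K : HeytingField c ℓ₁ ℓ₂) where
  open HeytingField K public
  open HeytingCommutativeRing heytingCommutativeRing public using (commutativeRing)
  open CommutativeRing commutativeRing public using (rawRing; semiring)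
  open Semiring semiring public using (rawSemiring; +-rawMonoid)
  open RawSemiringDefs rawSemiring public using (_^_)
  open RawMonoidDefs +-rawMonoid public using () renaming (_×_ to _·_)

HasCardinality : HeytingField c ℓ₁ ℓ₂ → ℕ → Set _
HasCardinality K q = Inverse (HeytingField.setoid K) (setoid (Fin q))

record Extension (K : HeytingField c ℓ₁ ℓ₂) : Set (suc (c ⊔ ℓ₁ ⊔ ℓ₂)) where
  field
    L   : HeytingField c ℓ₁ ℓ₂
    ι   : HeytingField.Carrier K → HeytingField.Carrier L
    hom : RingMorphisms.IsRingHomomorphism (Field.rawRing K) (Field.rawRing L) ι

-- The equation y² = x³ + a₄ x + a₆.
record Weierstrass (K : HeytingField c ℓ₁ ℓ₂) : Set c where
  constructor weierstrass
  field
    a₄ a₆ : HeytingField.Carrier K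

module _ {K : HeytingField c ℓ₁ ℓ₂} where
  open Field K

  discriminant : Weierstrass K → Carrier
  discriminant (weierstrass a₄ a₆) = - (16 · (4 · (a₄ ^ 3) + 27 · (a₆ ^ 2)))

  IsElliptic : Weierstrass K → Set ℓ₂
  IsElliptic E = discriminant E # 0#

  TypeI⁺ : Weierstrass K → Set (c ⊔ ℓ₁ ⊔ ℓ₂)
  TypeI⁺ E = a₄ # 0# × ∃ λ u → u # 0# × a₄ ≈ u ^ 4
    where open Weierstrass E

-- Homogeneous coordinates [X : Y : Z] on the projective plane.
module Plane (L : HeytingField c ℓ₁ ℓ₂) where
  open Field L

  Coords : Set c
  Coords = Fin 3 → Carrier

  NonZero : Coords → Set ℓ₂
  NonZero P = ∃ λ i → P i # 0#

  infix 4 _∼_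
  _∼_ : Coords → Coords → Set (c ⊔ ℓ₁ ⊔ ℓ₂)
  P ∼ Q = ∃ λ t → t # 0# × (∀ i → P i ≈ t * Q i)

-- Homogeneous polynomials of degree n in X, Y, Z, as formal sums of terms
-- coeff · Xⁱ Yʲ Zᵏ; repeated monomials are allowed.
record Term (K : HeytingField c ℓ₁ ℓ₂) (n : ℕ) : Set c where
  constructor term
  field
    coeff  : HeytingField.Carrier K
    i j k  : ℕ
    degree : i ℕ.+ j ℕ.+ k ≡ n

Form : HeytingField c ℓ₁ ℓ₂ → ℕ → Set _
Form K n = List (Term K n)

module _ {K : HeytingField c ℓ₁ ℓ₂} (X : Extension K) where
  open Extension X
  open Field L
  open Plane L

  evalTerm : ∀ {n} → Term K n → Coords → Carrier
  evalTerm (term a i j k _) P = ι a * (P 0F ^ i * P 1F ^ j * P 2F ^ k)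

  eval : ∀ {n} → Form K n → Coords → Carrier
  eval F P = foldr (λ t s → evalTerm t P + s) 0# F

  -- Y² Z = X³ + a₄ X Z² + a₆ Z³
  OnCurve : Weierstrass K → Coords → Set ℓ₁
  OnCurve (weierstrass a₄ a₆) P = y ^ 2 * z ≈ x ^ 3 + ι a₄ * (x * z ^ 2) + ι a₆ * z ^ 3
    where
    x = P 0F
    y = P 1F
    z = P 2F

  record Point (E : Weierstrass K) : Set (c ⊔ ℓ₁ ⊔ ℓ₂) where
    constructor point
    field
      coords  : Coords
      nonZero : NonZero coords
      onCurve : OnCurve E coords

  infix 4 _≃_
  _≃_ : ∀ {E} → Point E → Point E → Set (c ⊔ ℓ₁ ⊔ ℓ₂)
  P ≃ Q = Point.coords P ∼ Point.coords Q

  -- The point at infinity [0 : 1 : 0].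
  𝒪 : ∀ {E} → Point E
  𝒪 {weierstrass a₄ a₆} = point O (1F , 1#0) O∈E
    where
    open SetoidReasoning (HeytingField.setoid L)

    O : Coords
    O 0F = 0#
    O 1F = 1#
    O 2F = 0#

    1-0≈1 : 1# - 0# ≈ 1#
    1-0≈1 = begin
      1# + - 0#        ≈⟨ +-cong refl (+-identityˡ (- 0#)) ⟨
      1# + (0# + - 0#) ≈⟨ +-cong refl (-‿inverseʳ 0#) ⟩
      1# + 0#          ≈⟨ +-identityʳ 1# ⟩
      1#               ∎

    1#0 : 1# # 0#
    1#0 = invertible⇒# (1# , trans (*-identityˡ _) 1-0≈1 , trans (*-identityʳ _) 1-0≈1)

    O∈E : OnCurve (weierstrass a₄ a₆) O
    O∈E = begin
      1# ^ 2 * 0#                                       ≈⟨ zeroʳ _ ⟩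
      0#                                                ≈⟨ +-identityʳ 0# ⟨
      0# + 0#                                           ≈⟨ +-identityʳ _ ⟨
      0# + 0# + 0#
        ≈⟨ +-cong (+-cong (zeroˡ _) (trans (*-congˡ (zeroˡ _)) (zeroʳ _))) (trans (*-congˡ (zeroˡ _)) (zeroʳ _)) ⟨
      0# ^ 3 + ι a₄ * (0# * 0# ^ 2) + ι a₆ * 0# ^ 3     ∎

-- A morphism of projective plane curves defined over K: finitely many triples
-- of forms of equal degree over K such that at each point of E at least one
-- triple does not vanish, and all triples that do not vanish there give the
-- same point of E′.  The points are those over all extension fields of K, and
-- so in particular the geometric ones; K-points alone would not suffice.
record Morphism {K : HeytingField c ℓ₁ ℓ₂} (E E′ : Weierstrass K) : Set (suc (c ⊔ ℓ₁ ⊔ ℓ₂)) where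
  field
    size   : ℕ
    degree : Fin size → ℕ
    forms  : (s : Fin size) → Fin 3 → Form K (degree s)

  at : (X : Extension K) → Fin size → Point X E → Plane.Coords (Extension.L X)
  at X s P i = eval X (forms s i) (Point.coords P)

  DefinedAt : (X : Extension K) → Fin size → Point X E → Set ℓ₂
  DefinedAt X s P = Plane.NonZero (Extension.L X) (at X s P)

  field
    regular  : ∀ X (P : Point X E) → ∃ λ s → DefinedAt X s P
    image    : ∀ X (P : Point X E) s → DefinedAt X s P → OnCurve X E′ (at X s P)
    coherent : ∀ X (P : Point X E) s t → DefinedAt X s P → DefinedAt X t P →
               Plane._∼_ (Extension.L X) (at X s P) (at X t P)

  apply : ∀ X → Point X E → Point X E′
  apply X P = point (at X s P) def (image X P s def)
    where
    s   = proj₁ (regular X P)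
    def = proj₂ (regular X P)

-- Isomorphism over K of elliptic curves, i.e. of curves with base point 𝒪.
record _≅_ {K : HeytingField c ℓ₁ ℓ₂} (E E′ : Weierstrass K) : Set (suc (c ⊔ ℓ₁ ⊔ ℓ₂)) where
  field
    to      : Morphism E E′
    from    : Morphism E′ E
    from∘to : ∀ X P → _≃_ X (Morphism.apply from X (Morphism.apply to X P)) P
    to∘from : ∀ X P → _≃_ X (Morphism.apply to X (Morphism.apply from X P)) P
    to-𝒪    : ∀ X → _≃_ X (Morphism.apply to X (𝒪 X)) (𝒪 X)

infix 4 _≅_

y²=x³+x : (K : HeytingField c ℓ₁ ℓ₂) → Weierstrass K
y²=x³+x K = weierstrass 1# 0#
  where open HeytingField K

{-# OPTIONS --safe #-}
-- In characteristic 3 the substitution x = u²x′ + r, y = u³y′ turns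
-- y² = x³ + a₄x + a₆ into y² = x³ + a₄′x + a₆′ exactly when u⁴a₄′ = a₄ and
-- u⁶a₆′ = r³ + a₄r + a₆.  If a₄ = u⁴, reaching y² = x³ + x therefore amounts
-- to solving ρ³ + ρ + b = 0 for a given b ∈ 𝔽_q.  The Frobenius φ = (·)³ is
-- additive with φᵈ = 1, and d is odd, so that φ + 1 divides φᵈ + 1 = 2 = −1
-- and ρ can be written down explicitly.
module Submission where

open import Defs
open import Algebra.Apartness.Bundles using (HeytingField)
open import Algebra.Bundles using (CommutativeRing)
open import Algebra.Morphism.Structures using (module RingMorphisms)
open import Data.Fin.Base using (Fin; zero; suc)
open import Data.Fin.Patterns using (0F; 1F; 2F)
open import Data.Fin.Permutation using (Permutation; permutation)
open import Data.Fin.Properties using (_≟_; punchInᵢ≢i)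
open import Data.List.Base using ([]; _∷_)
open import Data.Nat.Base as ℕ using (ℕ; zero; suc; _^_; _%_)
import Data.Nat.Properties as ℕ
open import Data.Product.Base using (∃; _×_; _,_; proj₁; proj₂)
open import Data.Sum.Base using (_⊎_; inj₁; inj₂; [_,_])
open import Data.Vec.Functional using (Vector; replicate; removeAt)
open import Function.Base using (_∘_)
open import Function.Bundles using (Inverse)
open import Level using (_⊔_)
open import Relation.Binary.PropositionalEquality.Core as ≡ using (_≡_; _≢_)
open import Relation.Nullary using (¬_; yes; no; contradiction)
import Algebra.Apartness.Properties.HeytingCommutativeRing as HeytingProperties
import Algebra.Properties.CommutativeMonoid.Sum as FiniteSum
import Algebra.Properties.Ring as RingProperties
import Algebra.Properties.Semiring.Exp as Exponentiation
import Algebra.Properties.Semiring.Mult as Multiples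
import Algebra.Solver.Ring.NaturalCoefficients.Default as SemiringSolver
import Relation.Binary.Reasoning.Setoid as SetoidReasoning

-- Apartness, units and characteristic 3 in a Heyting field.

module FieldProperties {c ℓ₁ ℓ₂} (K : HeytingField c ℓ₁ ℓ₂) where
  open Field K hiding (zero) renaming (_^_ to infixl 8 _↑_)
  open CommutativeRing commutativeRing using (ring; commutativeSemiring)
  open HeytingProperties heytingCommutativeRing public
    using (x-0≈x; 1#0; x#0y#0→xy#0; #-congʳ; invertibleˡ⇒#)
  open RingProperties ring public using (-‿distribʳ-*; +-cancelʳ; -1*x≈-x)
  open Exponentiation semiring public using (^-congˡ; ^-assocʳ; ^-congʳ)
  open SemiringSolver commutativeSemiring using (solve; _:=_; _:+_; _:*_; _:^_; _:×_)
  open SetoidReasoning setoid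

  #0⇒unit : ∀ {x} → x # 0# → ∃ λ y → x * y ≈ 1#
  #0⇒unit {x} x#0 with y , _ , eq ← #⇒invertible x#0 = y , trans (*-congʳ (sym (x-0≈x x))) eq

  unit⇒#0 : ∀ {x y} → x * y ≈ 1# → x # 0#
  unit⇒#0 {x} {y} xy≈1 =
    invertibleˡ⇒# (y , trans (*-congˡ (x-0≈x x)) (trans (*-comm y x) xy≈1))

  x*y#0⇒x#0 : ∀ {x y} → x * y # 0# → x # 0#
  x*y#0⇒x#0 xy#0 with z , eq ← #0⇒unit xy#0 = unit⇒#0 (trans (sym (*-assoc _ _ z)) eq)

  x*y#0⇒y#0 : ∀ {x y} → x * y # 0# → y # 0#
  x*y#0⇒y#0 {x} {y} xy#0 = x*y#0⇒x#0 (#-congʳ (*-comm x y) xy#0)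

  x#y⇒x-y#0 : ∀ {x y} → x # y → x - y # 0#
  x#y⇒x-y#0 x#y with z , _ , eq ← #⇒invertible x#y = unit⇒#0 eq

  -- Cotransitivity puts `x + y` apart from `0#` or from `x`; in the second case the difference,
  -- which is `y`, is apart from `0#`. This later shows that a shear of coordinates keeps a point
  -- non-zero.
  x#0⇒x+y#0⊎y#0 : ∀ {x y} → x # 0# → x + y # 0# ⊎ y # 0#
  x#0⇒x+y#0⊎y#0 {x} {y} x#0 with #-cotrans x#0 (x + y)
  ... | inj₂ x+y#0 = inj₁ x+y#0
  ... | inj₁ x#x+y = inj₂ (#-congʳ x+y-x≈y (x#y⇒x-y#0 (#-sym x#x+y)))
    where
    x+y-x≈y : x + y - x ≈ y
    x+y-x≈y = begin
      x + y - x   ≈⟨ +-congʳ (+-comm x y) ⟩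
      y + x - x   ≈⟨ +-assoc y x (- x) ⟩
      y + (x - x) ≈⟨ +-congˡ (-‿inverseʳ x) ⟩
      y + 0#      ≈⟨ +-identityʳ y ⟩
      y           ∎

  ¬#0⇒≈0 : ∀ {x} → ¬ x # 0# → x ≈ 0#
  ¬#0⇒≈0 = proj₁ (tight _ _)

  *-cancelˡ-≈0 : ∀ {x y} → x # 0# → x * y ≈ 0# → y ≈ 0#
  *-cancelˡ-≈0 {x} {y} x#0 xy≈0 with z , xz≈1 ← #0⇒unit x#0 = begin
    y           ≈⟨ *-identityˡ y ⟨
    1# * y      ≈⟨ *-congʳ (trans (*-comm z x) xz≈1) ⟨
    z * x * y   ≈⟨ *-assoc z x y ⟩
    z * (x * y) ≈⟨ *-congˡ xy≈0 ⟩
    z * 0#      ≈⟨ zeroʳ z ⟩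
    0#          ∎

  -- If `x * y` vanished, `x # 0#` would force `y ≈ 0#`; so `x # 0#` is impossible and tightness
  -- gives `x ≈ 0#`. The negated equality suits the enumerated elements below, where distinct
  -- indices yield only inequality.
  x*y≉0 : ∀ {x y} → ¬ x ≈ 0# → ¬ y ≈ 0# → ¬ x * y ≈ 0#
  x*y≉0 x≉0 y≉0 xy≈0 = x≉0 (¬#0⇒≈0 λ x#0 → y≉0 (*-cancelˡ-≈0 x#0 xy≈0))

  1≉0 : ¬ 1# ≈ 0#
  1≉0 1≈0 = #-irrefl 1≈0 1#0

  ^-#0 : ∀ {x} n → x # 0# → x ↑ n # 0#
  ^-#0 zero    x#0 = 1#0
  ^-#0 (suc n) x#0 = x#0y#0→xy#0 x#0 (^-#0 n x#0)

  Char3 : Set _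
  Char3 = ∀ x → 3 · x ≈ 0#

  -- Identities special to characteristic 3 are split in two: a semiring identity gathers the
  -- surplus into one summand `3 · y`, which is then dropped here.
  +-3· : Char3 → ∀ x y → x + 3 · y ≈ x
  +-3· char3 x y = trans (+-congˡ (char3 y)) (+-identityʳ x)

  cube-+ : Char3 → ∀ x y → (x + y) ↑ 3 ≈ x ↑ 3 + y ↑ 3
  cube-+ char3 x y = begin
    (x + y) ↑ 3
      ≈⟨ solve 2 (λ x y → (x :+ y) :^ 3 :=
                          x :^ 3 :+ y :^ 3 :+ 3 :× (x :* x :* y :+ x :* y :* y)) refl x y ⟩
    x ↑ 3 + y ↑ 3 + 3 · (x * x * y + x * y * y)
      ≈⟨ +-3· char3 _ _ ⟩
    x ↑ 3 + y ↑ 3 ∎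

  u*v≈1⇒u^n*v^n≈1 : ∀ {u v} n → u * v ≈ 1# → u ↑ n * v ↑ n ≈ 1#
  u*v≈1⇒u^n*v^n≈1 zero uv≈1 = *-identityˡ 1#
  u*v≈1⇒u^n*v^n≈1 {u} {v} (suc n) uv≈1 = begin
    u * u ↑ n * (v * v ↑ n)
      ≈⟨ solve 4 (λ u v p q → u :* p :* (v :* q) := u :* v :* (p :* q)) refl u v (u ↑ n) (v ↑ n) ⟩
    u * v * (u ↑ n * v ↑ n) ≈⟨ *-cong uv≈1 (u*v≈1⇒u^n*v^n≈1 n uv≈1) ⟩
    1# * 1#                 ≈⟨ *-identityˡ 1# ⟩
    1#                      ∎

-- Finite products with one factor left out.

module Products {c ℓ₁ ℓ₂} (K : HeytingField c ℓ₁ ℓ₂) where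
  open Field K hiding (zero) renaming (_^_ to infixl 8 _↑_)
  open FieldProperties K
  open CommutativeRing commutativeRing using (*-commutativeMonoid)
  open FiniteSum *-commutativeMonoid public
    using (sum-remove; sum-cong-≗; sum-cong-≋; sum-permute; sum-replicate)
    renaming (sum to ∏; ∑-distrib-+ to ∏-distrib-*)
  open SetoidReasoning setoid

  -- The factor is replaced by `1#` instead of being removed, so the index set stays `Fin n` and a
  -- permutation of all field elements can reindex a product over the non-zero ones.
  except : ∀ {n} → Fin n → Vector Carrier n → Vector Carrier n
  except k f i with i ≟ k
  ... | yes _ = 1#
  ... | no  _ = f i

  except-≢ : ∀ {n} {k : Fin n} f {i} → i ≢ k → except k f i ≡ f i
  except-≢ {k = k} f {i} i≢k with i ≟ k
  ... | yes i≡k = contradiction i≡k i≢k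
  ... | no  _   = ≡.refl

  except-≡ : ∀ {n} (k : Fin n) f → except k f k ≡ 1#
  except-≡ k f with k ≟ k
  ... | yes _   = ≡.refl
  ... | no  k≢k = contradiction ≡.refl k≢k

  ∏-except : ∀ {n} (k : Fin n) f → f k * ∏ (except k f) ≈ ∏ f
  ∏-except {suc n} k f = begin
    f k * ∏ (except k f)
      ≈⟨ *-congˡ (sum-remove {i = k} (except k f)) ⟩
    f k * (except k f k * ∏ (removeAt (except k f) k))
      ≡⟨ ≡.cong (λ x → f k * (x * ∏ (removeAt (except k f) k))) (except-≡ k f) ⟩
    f k * (1# * ∏ (removeAt (except k f) k))
      ≈⟨ *-congˡ (*-identityˡ _) ⟩
    f k * ∏ (removeAt (except k f) k)
      ≡⟨ ≡.cong (f k *_) (sum-cong-≗ {n} {removeAt (except k f) k} {removeAt f k}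
           (λ i → except-≢ f (punchInᵢ≢i k i))) ⟩
    f k * ∏ (removeAt f k)
      ≈⟨ sum-remove {i = k} f ⟨
    ∏ f ∎

  ∏≉0 : ∀ {n} (f : Vector Carrier n) → (∀ i → ¬ f i ≈ 0#) → ¬ ∏ f ≈ 0#
  ∏≉0 {zero}  f f≉0 = 1≉0
  ∏≉0 {suc n} f f≉0 = x*y≉0 (f≉0 zero) (∏≉0 (f ∘ suc) (f≉0 ∘ suc))

-- Finite fields: the order annihilates 1, and every element satisfies xᑫ = x.

module FiniteField {c ℓ₁ ℓ₂} (K : HeytingField c ℓ₁ ℓ₂) {q : ℕ} (card : HasCardinality K q) where
  open Field K hiding (zero) renaming (_^_ to infixl 8 _↑_)
  open FieldProperties K
  open CommutativeRing commutativeRing using (+-commutativeMonoid)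
  open Products K
  open Inverse card using (to; from; to-cong; strictlyInverseˡ; strictlyInverseʳ)
  open SetoidReasoning setoid

  from-to : ∀ x → from (to x) ≈ x
  from-to = strictlyInverseʳ

  -- Translations and scalings of the field are turned into permutations of indices, by which sums
  -- and products over all elements can be reindexed.
  conjugate : (f g : Carrier → Carrier) →
              (∀ {x y} → x ≈ y → f x ≈ f y) → (∀ {x y} → x ≈ y → g x ≈ g y) →
              (∀ x → f (g x) ≈ x) → (∀ x → g (f x) ≈ x) → Permutation q q
  conjugate f g f-cong g-cong fg gf = permutation
    (to ∘ f ∘ from) (to ∘ g ∘ from) (inv f g f-cong fg) (inv g f g-cong gf)
    where
    inv : (f g : Carrier → Carrier) → (∀ {x y} → x ≈ y → f x ≈ f y) → (∀ x → f (g x) ≈ x) →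
          ∀ i → to (f (from (to (g (from i))))) ≡ i
    inv f g f-cong fg i =
      ≡.trans (to-cong (trans (f-cong (from-to _)) (fg _))) (strictlyInverseˡ i)

  module Add = FiniteSum +-commutativeMonoid

  -- The translation by `1#` permutes the field, so the sum of all `1# + x` equals the sum of all
  -- `x`; cancelling that sum leaves `q · 1#`.
  q·1≈0 : q · 1# ≈ 0#
  q·1≈0 = +-cancelʳ (Add.sum from) _ _ (begin
    q · 1# + Add.sum from                             ≈⟨ +-congʳ (Add.sum-replicate q) ⟨
    Add.sum (replicate q 1#) + Add.sum from           ≈⟨ Add.∑-distrib-+ (replicate q 1#) from ⟨
    Add.sum (λ i → 1# + from i)                       ≈⟨ Add.sum-cong-≋ {q} (λ i → from-to (1# + from i)) ⟨
    Add.sum (λ i → from (to (1# + from i)))           ≈⟨ Add.sum-permute from shift ⟨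
    Add.sum from                                      ≈⟨ +-identityˡ _ ⟨
    0# + Add.sum from                                 ∎)
    where
    cancel : ∀ {a b} → a + b ≈ 0# → ∀ x → a + (b + x) ≈ x
    cancel a+b≈0 x = trans (sym (+-assoc _ _ x)) (trans (+-congʳ a+b≈0) (+-identityˡ x))

    shift : Permutation q q
    shift = conjugate (1# +_) (- 1# +_) +-congˡ +-congˡ
                      (cancel (-‿inverseʳ 1#)) (cancel (-‿inverseˡ 1#))

  index₀ : Fin q
  index₀ = to 0#

  ∏ₓ≢₀x : Carrier
  ∏ₓ≢₀x = ∏ (except index₀ from)

  ∏ₓ≢₀x≉0 : ¬ ∏ₓ≢₀x ≈ 0#
  ∏ₓ≢₀x≉0 = ∏≉0 (except index₀ from) except≉0
    where
    except≉0 : ∀ i → ¬ except index₀ from i ≈ 0#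
    except≉0 i with i ≟ index₀
    ... | yes _  = 1≉0
    ... | no i≢0 = λ xᵢ≈0 → i≢0 (≡.trans (≡.sym (strictlyInverseˡ i)) (to-cong xᵢ≈0))

  -- The first factor is a^{q-1}, written as a product over the non-zero elements. Scaling by the
  -- unit `a` permutes these elements and fixes zero, so it leaves their product unchanged.
  unit-fixes-∏ : ∀ {a} → a # 0# → ∏ (except index₀ (replicate q a)) * ∏ₓ≢₀x ≈ ∏ₓ≢₀x
  unit-fixes-∏ {a} a#0 with b , ab≈1 ← #0⇒unit a#0 = begin
    ∏ A * ∏ (except index₀ from)                   ≈⟨ ∏-distrib-* A (except index₀ from) ⟨
    ∏ (λ i → A i * except index₀ from i)           ≈⟨ sum-cong-≋ scaled ⟩
    ∏ (λ i → except index₀ from (to (a * from i))) ≈⟨ sum-permute (except index₀ from) scale ⟨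
    ∏ₓ≢₀x                                          ∎
    where
    A : Vector Carrier q
    A = except index₀ (replicate q a)

    cancel : ∀ {a b} → a * b ≈ 1# → ∀ x → a * (b * x) ≈ x
    cancel ab≈1 x = trans (sym (*-assoc _ _ x)) (trans (*-congʳ ab≈1) (*-identityˡ x))

    ba≈1 : b * a ≈ 1#
    ba≈1 = trans (*-comm b a) ab≈1

    scale : Permutation q q
    scale = conjugate (a *_) (b *_) *-congˡ *-congˡ (cancel ab≈1) (cancel ba≈1)

    scaled : ∀ i → A i * except index₀ from i ≈ except index₀ from (to (a * from i))
    scaled i with i ≟ index₀ | to (a * from i) ≟ index₀
    ... | yes _   | yes _   = *-identityˡ 1#
    ... | no  _   | no  _   = sym (from-to _)
    -- The mixed cases are contradictory: `a` times zero is zero, and cancelling the unit `a` shows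
    -- that only zero is sent to zero.
    ... | yes i≡0 | no  j≢0 = contradiction (to-cong (begin
      a * from i      ≡⟨ ≡.cong (λ i → a * from i) i≡0 ⟩
      a * from index₀ ≈⟨ *-congˡ (from-to 0#) ⟩
      a * 0#          ≈⟨ zeroʳ a ⟩
      0#              ∎)) j≢0
    ... | no  i≢0 | yes j≡0 = contradiction (≡.trans (≡.sym (strictlyInverseˡ i)) (to-cong (begin
      from i                        ≈⟨ cancel ba≈1 (from i) ⟨
      b * (a * from i)              ≈⟨ *-congˡ (from-to _) ⟨
      b * from (to (a * from i))    ≡⟨ ≡.cong (λ j → b * from j) j≡0 ⟩
      b * from index₀               ≈⟨ *-congˡ (from-to 0#) ⟩
      b * 0#                        ≈⟨ zeroʳ b ⟩
      0#                            ∎))) i≢0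

  -- If aᑫ # a then a is invertible and a^{q−1} − 1 is an invertible
  -- annihilator of the product of the non-zero elements.
  x^q≈x : ∀ a → a ↑ q ≈ a
  x^q≈x a = proj₁ (tight _ _) λ a^q#a →
    let a[H-1]#0 = #-congʳ difference (x#y⇒x-y#0 a^q#a)
    in ∏ₓ≢₀x≉0 (*-cancelˡ-≈0 (x*y#0⇒y#0 a[H-1]#0) (annihilates (x*y#0⇒x#0 a[H-1]#0)))
    where
    H : Carrier
    H = ∏ (except index₀ (replicate q a))

    difference : a ↑ q - a ≈ a * (H - 1#)
    difference = begin
      a ↑ q - a
        ≈⟨ +-cong (sum-replicate q) (-‿cong (*-identityʳ a)) ⟨
      ∏ (replicate q a) - a * 1#
        ≈⟨ +-cong (sym (∏-except index₀ (replicate q a))) (-‿distribʳ-* a 1#) ⟩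
      a * H + a * - 1#
        ≈⟨ distribˡ a H (- 1#) ⟨
      a * (H - 1#) ∎

    annihilates : a # 0# → (H - 1#) * ∏ₓ≢₀x ≈ 0#
    annihilates a#0 = begin
      (H - 1#) * ∏ₓ≢₀x          ≈⟨ distribʳ ∏ₓ≢₀x H (- 1#) ⟩
      H * ∏ₓ≢₀x + - 1# * ∏ₓ≢₀x  ≈⟨ +-cong (unit-fixes-∏ a#0) (-1*x≈-x _) ⟩
      ∏ₓ≢₀x - ∏ₓ≢₀x             ≈⟨ -‿inverseʳ _ ⟩
      0#                        ∎

-- Fields with 3ᵈ elements and the equation r³ + r + b = 0.

module CardinalityPowerOf3 {c ℓ₁ ℓ₂} (K : HeytingField c ℓ₁ ℓ₂) (d : ℕ)
                           (card : HasCardinality K (3 ^ d)) where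
  open Field K hiding (zero) renaming (_^_ to infixl 8 _↑_)
  open FieldProperties K
  open FiniteField K card using (q·1≈0; x^q≈x)
  open CommutativeRing commutativeRing using (commutativeSemiring)
  open Multiples semiring using (×1-homo-*; ×-assoc-*; ×-congʳ)
  open SemiringSolver commutativeSemiring using (solve; _:=_; _:+_; _:×_)
  open SetoidReasoning setoid

  -- If `3 · 1#` were apart from zero, so would be its d-th power, which is `(3 ^ d) · 1#`; but the
  -- order of the field annihilates `1#`.
  char3 : Char3
  char3 x = begin
    3 · x         ≈⟨ ×-congʳ 3 (*-identityˡ x) ⟨
    3 · (1# * x)  ≈⟨ ×-assoc-* 3 1# x ⟨
    (3 · 1#) * x  ≈⟨ *-congʳ (¬#0⇒≈0 λ 3#0 → #-irrefl q·1≈0 (3^n#0 3#0 d)) ⟩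
    0# * x        ≈⟨ zeroˡ x ⟩
    0#            ∎
    where
    3^n#0 : 3 · 1# # 0# → ∀ n → (3 ^ n) · 1# # 0#
    3^n#0 3#0 zero    = #-congʳ (sym (+-identityʳ 1#)) 1#0
    3^n#0 3#0 (suc n) = #-congʳ (sym (×1-homo-* 3 (3 ^ n))) (x#0y#0→xy#0 3#0 (3^n#0 3#0 n))

  -- The solution for an odd exponent n is the partial alternating sum
  -- b − φb + φ²b − ⋯ + φⁿ⁻¹b, written with −1 = 2.
  φ+1-divides-φⁿ+1 : ∀ b n → n % 2 ≡ 1 → ∃ λ r → r ↑ 3 + r ≈ b + b ↑ (3 ^ n)
  φ+1-divides-φⁿ+1 b 1 _ = b , +-comm (b ↑ 3) b
  φ+1-divides-φⁿ+1 b (suc (suc n)) odd with r , r³+r≈ ← φ+1-divides-φⁿ+1 b n odd =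
    -- The recursion is s ↦ b - φb + φ²s. Applying φ + 1 turns b - φb into b - φ²b, and φ²s into φ²b
    -- + φⁿ⁺²b by induction; the terms φ²b cancel.
    b + (b³ + b³) + r ↑ 3 ↑ 3 , (begin
      (b + (b³ + b³) + r ↑ 3 ↑ 3) ↑ 3 + (b + (b³ + b³) + r ↑ 3 ↑ 3)
        ≈⟨ +-congʳ (trans (cube-+ char3 _ _) (+-congʳ
             (trans (cube-+ char3 _ _) (+-congˡ (cube-+ char3 _ _))))) ⟩
      b³ + (b³ ↑ 3 + b³ ↑ 3) + r ↑ 3 ↑ 3 ↑ 3 + (b + (b³ + b³) + r ↑ 3 ↑ 3)
        ≈⟨ solve 5 (λ b c e x y → c :+ (e :+ e) :+ x :+ (b :+ (c :+ c) :+ y) :=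
                                  b :+ (e :+ e) :+ (x :+ y) :+ 3 :× c)
                 refl b b³ (b³ ↑ 3) (r ↑ 3 ↑ 3 ↑ 3) (r ↑ 3 ↑ 3) ⟩
      b + (b³ ↑ 3 + b³ ↑ 3) + (r ↑ 3 ↑ 3 ↑ 3 + r ↑ 3 ↑ 3) + 3 · b³
        ≈⟨ +-3· char3 _ _ ⟩
      b + (b³ ↑ 3 + b³ ↑ 3) + (r ↑ 3 ↑ 3 ↑ 3 + r ↑ 3 ↑ 3)
        ≈⟨ +-congˡ φ²[r³+r] ⟩
      b + (b³ ↑ 3 + b³ ↑ 3) + (b³ ↑ 3 + b ↑ (3 ^ n) ↑ 3 ↑ 3)
        ≈⟨ solve 3 (λ b e y → b :+ (e :+ e) :+ (e :+ y) := b :+ y :+ 3 :× e)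
                 refl b (b³ ↑ 3) (b ↑ (3 ^ n) ↑ 3 ↑ 3) ⟩
      b + b ↑ (3 ^ n) ↑ 3 ↑ 3 + 3 · (b³ ↑ 3)
        ≈⟨ +-3· char3 _ _ ⟩
      b + b ↑ (3 ^ n) ↑ 3 ↑ 3
        ≈⟨ +-congˡ (trans (^-congˡ 3 (^3 b (3 ^ n))) (^3 b (3 ℕ.* 3 ^ n))) ⟩
      b + b ↑ (3 ^ suc (suc n)) ∎)
    where
    b³ : Carrier
    b³ = b ↑ 3

    ^3 : ∀ x m → x ↑ m ↑ 3 ≈ x ↑ (3 ℕ.* m)
    ^3 x m = trans (^-assocʳ x m 3) (^-congʳ x (ℕ.*-comm m 3))

    φ²[r³+r] : r ↑ 3 ↑ 3 ↑ 3 + r ↑ 3 ↑ 3 ≈ b³ ↑ 3 + b ↑ (3 ^ n) ↑ 3 ↑ 3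
    φ²[r³+r] = begin
      r ↑ 3 ↑ 3 ↑ 3 + r ↑ 3 ↑ 3       ≈⟨ cube-+ char3 _ _ ⟨
      (r ↑ 3 ↑ 3 + r ↑ 3) ↑ 3         ≈⟨ ^-congˡ 3 (cube-+ char3 _ _) ⟨
      (r ↑ 3 + r) ↑ 3 ↑ 3             ≈⟨ ^-congˡ 3 (^-congˡ 3 r³+r≈) ⟩
      (b + b ↑ (3 ^ n)) ↑ 3 ↑ 3       ≈⟨ ^-congˡ 3 (cube-+ char3 _ _) ⟩
      (b³ + b ↑ (3 ^ n) ↑ 3) ↑ 3      ≈⟨ cube-+ char3 _ _ ⟩
      b³ ↑ 3 + b ↑ (3 ^ n) ↑ 3 ↑ 3    ∎

  -- As φᵈ is the identity, the preceding division gives r³ + r = b + b, so adding `b` once more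
  -- makes `3 · b`.
  r³+r+b-root : d % 2 ≡ 1 → ∀ b → ∃ λ r → r ↑ 3 + r + b ≈ 0#
  r³+r+b-root odd b with r , r³+r≈ ← φ+1-divides-φⁿ+1 b d odd = r , (begin
    r ↑ 3 + r + b           ≈⟨ +-congʳ r³+r≈ ⟩
    b + b ↑ (3 ^ d) + b     ≈⟨ +-congʳ (+-congˡ (x^q≈x b)) ⟩
    b + b + b               ≈⟨ trans (+-comm (b + b) b) (+-congˡ (+-congˡ (sym (+-identityʳ b)))) ⟩
    3 · b                   ≈⟨ char3 b ⟩
    0#                      ∎)

-- Changes of variables between Weierstrass equations in characteristic 3.

module CurveChange {c ℓ₁ ℓ₂} (K : HeytingField c ℓ₁ ℓ₂) (char3 : FieldProperties.Char3 K) where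
  open Field K hiding (zero) renaming (_^_ to infixl 8 _↑_)
  open FieldProperties K
  open CommutativeRing commutativeRing using (commutativeSemiring)
  open SemiringSolver commutativeSemiring using (solve; _:=_; _:+_; _:*_; _:^_)
  open SetoidReasoning setoid

  rightSide : (a₄ a₆ x : Carrier) → Carrier
  rightSide a₄ a₆ x = x ↑ 3 + a₄ * x + a₆

  -- The substitution is x = u²x′ + r, y = u³y′: it expresses the coordinates
  -- on E by those on E′.
  record ChangeOfVariables (E E′ : Weierstrass K) : Set (c ⊔ ℓ₁) where
    private
      module E  = Weierstrass E
      module E′ = Weierstrass E′
    field
      u v r  : Carrier
      u*v≈1  : u * v ≈ 1#
      a₄-law : u ↑ 4 * E′.a₄ ≈ E.a₄
      a₆-law : u ↑ 6 * E′.a₆ ≈ rightSide E.a₄ E.a₆ r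

  open ChangeOfVariables

  -- The polynomial x³ + a₄x is additive in characteristic 3. Hence translating x creates no x² term
  -- and alters only the constant term.
  rightSide-+ : ∀ {a₄ a₆} x y → rightSide a₄ a₆ (x + y) ≈ x ↑ 3 + a₄ * x + rightSide a₄ a₆ y
  rightSide-+ {a₄} {a₆} x y = begin
    (x + y) ↑ 3 + a₄ * (x + y) + a₆ ≈⟨ +-congʳ (+-congʳ (cube-+ char3 x y)) ⟩
    x ↑ 3 + y ↑ 3 + a₄ * (x + y) + a₆
      ≈⟨ solve 6 (λ x y p q a₄ a₆ → p :+ q :+ a₄ :* (x :+ y) :+ a₆ :=
                  p :+ a₄ :* x :+ (q :+ a₄ :* y :+ a₆)) refl x y (x ↑ 3) (y ↑ 3) a₄ a₆ ⟩
    x ↑ 3 + a₄ * x + rightSide a₄ a₆ y ∎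

  u^n*[v^n*x]≈x : ∀ {u v} n x → u * v ≈ 1# → u ↑ n * (v ↑ n * x) ≈ x
  u^n*[v^n*x]≈x n x uv≈1 =
    trans (sym (*-assoc _ _ x)) (trans (*-congʳ (u*v≈1⇒u^n*v^n≈1 n uv≈1)) (*-identityˡ x))

  -- Solving x = u²x′ + r for x′ gives x′ = v²x - v²r, whence the new translation `- w`.
  flip : ∀ {E E′} → ChangeOfVariables E E′ → ChangeOfVariables E′ E
  flip {weierstrass a₄ a₆} {weierstrass a₄′ a₆′} S = record
    { u = v S ; v = u S ; r = - w ; u*v≈1 = vu≈1 ; a₄-law = a₄-law′
    ; a₆-law = begin
        v S ↑ 6 * a₆
          ≈⟨ +-identityˡ _ ⟨
        0# + v S ↑ 6 * a₆
          ≈⟨ +-congʳ 0≈ ⟨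
        -- Zero is written as the value of x³ + a₄′x at `- w + w`. Additivity splits off the part at
        -- `- w`; the part at `w` together with v⁶a₆ is v⁶ times the old law for a₆, that is a₆′.
        rightSide a₄′ 0# (- w + w) + v S ↑ 6 * a₆
          ≈⟨ +-congʳ (rightSide-+ (- w) w) ⟩
        (- w) ↑ 3 + a₄′ * - w + rightSide a₄′ 0# w + v S ↑ 6 * a₆
          ≈⟨ +-assoc _ _ _ ⟩
        (- w) ↑ 3 + a₄′ * - w + (rightSide a₄′ 0# w + v S ↑ 6 * a₆)
          ≈⟨ +-congˡ scaled ⟩
        rightSide a₄′ a₆′ (- w) ∎
    }
    where
    w : Carrier
    w = v S ↑ 2 * r S

    vu≈1 : v S * u S ≈ 1#
    vu≈1 = trans (*-comm (v S) (u S)) (u*v≈1 S)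

    a₄-law′ : v S ↑ 4 * a₄ ≈ a₄′
    a₄-law′ = trans (*-congˡ (sym (a₄-law S))) (u^n*[v^n*x]≈x 4 a₄′ vu≈1)

    0≈ : rightSide a₄′ 0# (- w + w) ≈ 0#
    0≈ = begin
      (- w + w) ↑ 3 + a₄′ * (- w + w) + 0# ≈⟨ +-identityʳ _ ⟩
      (- w + w) ↑ 3 + a₄′ * (- w + w) ≈⟨ +-cong (^-congˡ 3 (-‿inverseˡ w)) (*-congˡ (-‿inverseˡ w)) ⟩
      0# ↑ 3 + a₄′ * 0#               ≈⟨ +-cong (zeroˡ _) (zeroʳ a₄′) ⟩
      0# + 0#                         ≈⟨ +-identityˡ 0# ⟩
      0#                              ∎

    scaled : rightSide a₄′ 0# w + v S ↑ 6 * a₆ ≈ a₆′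
    scaled = begin
      w ↑ 3 + a₄′ * w + 0# + v S ↑ 6 * a₆
        ≈⟨ +-congʳ (trans (+-identityʳ _) (+-congˡ (*-congʳ (sym a₄-law′)))) ⟩
      w ↑ 3 + v S ↑ 4 * a₄ * w + v S ↑ 6 * a₆
        ≈⟨ solve 4 (λ v r a₄ a₆ →
             (v :^ 2 :* r) :^ 3 :+ v :^ 4 :* a₄ :* (v :^ 2 :* r) :+ v :^ 6 :* a₆ :=
             v :^ 6 :* (r :^ 3 :+ a₄ :* r :+ a₆)) refl (v S) (r S) a₄ a₆ ⟩
      v S ↑ 6 * rightSide a₄ a₆ (r S)
        ≈⟨ *-congˡ (a₆-law S) ⟨
      v S ↑ 6 * (u S ↑ 6 * a₆′)
        ≈⟨ u^n*[v^n*x]≈x 6 a₆′ vu≈1 ⟩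
      a₆′ ∎

  -- Inserting x′ = u′²x″ + r′ into x = u²x′ + r gives scale uu′ and translation u²r′ + r. It serves
  -- to join two curves through a common model.
  compose : ∀ {E E′ E″} → ChangeOfVariables E E′ → ChangeOfVariables E′ E″ → ChangeOfVariables E E″
  compose {weierstrass a₄ a₆} {weierstrass a₄′ a₆′} {weierstrass a₄″ a₆″} S T = record
    { u = u S * u T ; v = v S * v T ; r = u S ↑ 2 * r T + r S
    ; u*v≈1 = begin
        u S * u T * (v S * v T)
          ≈⟨ solve 4 (λ u u′ v v′ → u :* u′ :* (v :* v′) := u :* v :* (u′ :* v′)) refl (u S) (u T) (v S) (v T) ⟩
        u S * v S * (u T * v T) ≈⟨ *-cong (u*v≈1 S) (u*v≈1 T) ⟩
        1# * 1#                 ≈⟨ *-identityˡ 1# ⟩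
        1#                      ∎
    ; a₄-law = begin
        (u S * u T) ↑ 4 * a₄″
          ≈⟨ solve 3 (λ u u′ a → (u :* u′) :^ 4 :* a := u :^ 4 :* (u′ :^ 4 :* a)) refl (u S) (u T) a₄″ ⟩
        u S ↑ 4 * (u T ↑ 4 * a₄″) ≈⟨ *-congˡ (a₄-law T) ⟩
        u S ↑ 4 * a₄′             ≈⟨ a₄-law S ⟩
        a₄                        ∎
    ; a₆-law = begin
        (u S * u T) ↑ 6 * a₆″
          ≈⟨ solve 3 (λ u u′ a → (u :* u′) :^ 6 :* a := u :^ 6 :* (u′ :^ 6 :* a)) refl (u S) (u T) a₆″ ⟩
        u S ↑ 6 * (u T ↑ 6 * a₆″)
          ≈⟨ *-congˡ (a₆-law T) ⟩
        u S ↑ 6 * rightSide a₄′ a₆′ (r T)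
          ≈⟨ solve 4 (λ u r a₄ a₆ → u :^ 6 :* (r :^ 3 :+ a₄ :* r :+ a₆) :=
               (u :^ 2 :* r) :^ 3 :+ u :^ 4 :* a₄ :* (u :^ 2 :* r) :+ u :^ 6 :* a₆)
               refl (u S) (r T) a₄′ a₆′ ⟩
        (u S ↑ 2 * r T) ↑ 3 + u S ↑ 4 * a₄′ * (u S ↑ 2 * r T) + u S ↑ 6 * a₆′
          ≈⟨ +-cong (+-congˡ (*-congʳ (a₄-law S))) (a₆-law S) ⟩
        (u S ↑ 2 * r T) ↑ 3 + a₄ * (u S ↑ 2 * r T) + rightSide a₄ a₆ (r S)
          ≈⟨ rightSide-+ _ _ ⟨
        rightSide a₄ a₆ (u S ↑ 2 * r T + r S) ∎
    }

  -- Multiplying the equation of the second curve by u⁶ makes u⁴a₄′ and u⁶a₆′ appear, which the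
  -- coefficient laws replace.
  homogeneous-law :
    ∀ {a₄ a₆ a₄′ a₆′ x y z x′ y′}
    (S : ChangeOfVariables (weierstrass a₄ a₆) (weierstrass a₄′ a₆′)) →
    x ≈ u S ↑ 2 * x′ + r S * z → y ≈ u S ↑ 3 * y′ →
    y′ ↑ 2 * z ≈ x′ ↑ 3 + a₄′ * (x′ * z ↑ 2) + a₆′ * z ↑ 3 →
    y ↑ 2 * z ≈ x ↑ 3 + a₄ * (x * z ↑ 2) + a₆ * z ↑ 3
  homogeneous-law {a₄} {a₆} {a₄′} {a₆′} {x} {y} {z} {x′} {y′} S x≈ y≈ eq = begin
    y ↑ 2 * z
      ≈⟨ *-congʳ (^-congˡ 2 y≈) ⟩
    (u S ↑ 3 * y′) ↑ 2 * z
      ≈⟨ solve 3 (λ u y z → (u :^ 3 :* y) :^ 2 :* z := u :^ 6 :* (y :^ 2 :* z)) refl (u S) y′ z ⟩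
    u S ↑ 6 * (y′ ↑ 2 * z)
      ≈⟨ *-congˡ eq ⟩
    u S ↑ 6 * (x′ ↑ 3 + a₄′ * (x′ * z ↑ 2) + a₆′ * z ↑ 3)
      ≈⟨ solve 5 (λ u a₄ a₆ x z →
           u :^ 6 :* (x :^ 3 :+ a₄ :* (x :* z :^ 2) :+ a₆ :* z :^ 3) :=
           (u :^ 2 :* x) :^ 3 :+ u :^ 4 :* a₄ :* (u :^ 2 :* x :* z :^ 2) :+ u :^ 6 :* a₆ :* z :^ 3)
           refl (u S) a₄′ a₆′ x′ z ⟩
    (u S ↑ 2 * x′) ↑ 3 + u S ↑ 4 * a₄′ * (u S ↑ 2 * x′ * z ↑ 2) + u S ↑ 6 * a₆′ * z ↑ 3
      ≈⟨ +-cong (+-congˡ (*-congʳ (a₄-law S))) (*-congʳ (a₆-law S)) ⟩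
    (u S ↑ 2 * x′) ↑ 3 + a₄ * (u S ↑ 2 * x′ * z ↑ 2) + rightSide a₄ a₆ (r S) * z ↑ 3
      -- Here `p` is u²x′ and `q` its cube. Of the terms coming from the law for a₆, r³z³ completes
      -- the cube of u²x′ + rz and a₄rz³ completes the linear term.
      ≈⟨ solve 6 (λ p q a₄ a₆ r z →
           q :+ a₄ :* (p :* z :^ 2) :+ (r :^ 3 :+ a₄ :* r :+ a₆) :* z :^ 3 :=
           q :+ (r :* z) :^ 3 :+ a₄ :* ((p :+ r :* z) :* z :^ 2) :+ a₆ :* z :^ 3)
           refl (u S ↑ 2 * x′) ((u S ↑ 2 * x′) ↑ 3) a₄ a₆ (r S) z ⟩
    (u S ↑ 2 * x′) ↑ 3 + (r S * z) ↑ 3 + a₄ * ((u S ↑ 2 * x′ + r S * z) * z ↑ 2) + a₆ * z ↑ 3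
      ≈⟨ +-congʳ (+-congʳ (cube-+ char3 _ _)) ⟨
    (u S ↑ 2 * x′ + r S * z) ↑ 3 + a₄ * ((u S ↑ 2 * x′ + r S * z) * z ↑ 2) + a₆ * z ↑ 3
      ≈⟨ +-congʳ (+-cong (^-congˡ 3 x≈) (*-congˡ (*-congʳ x≈))) ⟨
    x ↑ 3 + a₄ * (x * z ↑ 2) + a₆ * z ↑ 3 ∎

  -- With r = u²ρ and a₄ = u⁴, the value r³ + a₄r + a₆ is u⁶(ρ³ + ρ + v⁶a₆). A root ρ thus makes the
  -- new constant term zero.
  reduction : ∀ {a₄ a₆ u v ρ} → a₄ ≈ u ↑ 4 → u * v ≈ 1# → ρ ↑ 3 + ρ + v ↑ 6 * a₆ ≈ 0# →
              ChangeOfVariables (weierstrass a₄ a₆) (y²=x³+x K)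
  reduction {a₄} {a₆} {u} {v} {ρ} a₄≈u⁴ uv≈1 ρ-root = record
    { u = u ; v = v ; r = u ↑ 2 * ρ ; u*v≈1 = uv≈1
    ; a₄-law = trans (*-identityʳ _) (sym a₄≈u⁴)
    ; a₆-law = begin
        u ↑ 6 * 0#
          ≈⟨ *-congˡ ρ-root ⟨
        u ↑ 6 * (ρ ↑ 3 + ρ + v ↑ 6 * a₆)
          ≈⟨ solve 3 (λ u ρ b → u :^ 6 :* (ρ :^ 3 :+ ρ :+ b) :=
               (u :^ 2 :* ρ) :^ 3 :+ u :^ 4 :* (u :^ 2 :* ρ) :+ u :^ 6 :* b)
               refl u ρ (v ↑ 6 * a₆) ⟩
        (u ↑ 2 * ρ) ↑ 3 + u ↑ 4 * (u ↑ 2 * ρ) + u ↑ 6 * (v ↑ 6 * a₆)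
          ≈⟨ +-cong (+-congˡ (*-congʳ (sym a₄≈u⁴))) (u^n*[v^n*x]≈x 6 a₆ uv≈1) ⟩
        rightSide a₄ a₆ (u ↑ 2 * ρ) ∎
    }

-- Monomials of degree one and base change to an extension field.

module Monomials {c ℓ₁ ℓ₂} (K : HeytingField c ℓ₁ ℓ₂) where
  open Field K hiding (zero) renaming (_^_ to infixl 8 _↑_)
  open Plane K using (Coords)

  monomial : ℕ → ℕ → ℕ → Coords → Carrier
  monomial i j k P = P 0F ↑ i * P 1F ↑ j * P 2F ↑ k

  monomial-x : ∀ P → monomial 1 0 0 P ≈ P 0F
  monomial-x P = trans (*-identityʳ _) (trans (*-identityʳ _) (*-identityʳ _))

  monomial-y : ∀ P → monomial 0 1 0 P ≈ P 1F
  monomial-y P = trans (*-identityʳ _) (trans (*-identityˡ _) (*-identityʳ _))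

  monomial-z : ∀ P → monomial 0 0 1 P ≈ P 2F
  monomial-z P = trans (*-cong (*-identityˡ _) (*-identityʳ _)) (*-identityˡ _)

module BaseChange {c ℓ₁ ℓ₂} {K : HeytingField c ℓ₁ ℓ₂} (X : Extension K) where
  open Extension X
  open RingMorphisms.IsRingHomomorphism hom public
  private
    module K = Field K
    module L = Field L
  open SetoidReasoning L.setoid

  ι-^ : ∀ x n → ι (x K.^ n) L.≈ ι x L.^ n
  ι-^ x zero    = 1#-homo
  ι-^ x (suc n) = L.trans (*-homo x (x K.^ n)) (L.*-congˡ (ι-^ x n))

  ι-· : ∀ n x → ι (n K.· x) L.≈ n L.· ι x
  ι-· zero    x = 0#-homo
  ι-· (suc n) x = L.trans (+-homo x (n K.· x)) (L.+-congˡ (ι-· n x))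

  ι-char3 : FieldProperties.Char3 K → FieldProperties.Char3 L
  ι-char3 char3 x = begin
    3 L.· x                  ≈⟨ ×-congʳ 3 (L.*-identityˡ x) ⟨
    3 L.· (L.1# L.* x)       ≈⟨ ×-assoc-* 3 L.1# x ⟨
    (3 L.· L.1#) L.* x       ≈⟨ L.*-congʳ (×-congʳ 3 1#-homo) ⟨
    (3 L.· ι K.1#) L.* x     ≈⟨ L.*-congʳ (ι-· 3 K.1#) ⟨
    ι (3 K.· K.1#) L.* x     ≈⟨ L.*-congʳ (L.trans (⟦⟧-cong (char3 K.1#)) 0#-homo) ⟩
    L.0# L.* x               ≈⟨ L.zeroˡ x ⟩
    L.0#                     ∎
    where open Multiples L.semiring using (×-assoc-*; ×-congʳ)

  ι-curve : Weierstrass K → Weierstrass L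
  ι-curve (weierstrass a₄ a₆) = weierstrass (ι a₄) (ι a₆)

-- Isomorphisms of projective curves from changes of variables.

module _ {c ℓ₁ ℓ₂} {K : HeytingField c ℓ₁ ℓ₂} (char3 : FieldProperties.Char3 K) where
  private
    module K = Field K
    module CK = CurveChange K char3
  open CK.ChangeOfVariables

  module Over (X : Extension K) where
    open Extension X public
    open BaseChange X public
    open Field L public hiding (zero) renaming (_^_ to infixl 8 _↑_)
    open FieldProperties L public
    open Monomials L public
    open CurveChange L (ι-char3 char3) public
    open CommutativeRing commutativeRing public using (commutativeSemiring)
    open SetoidReasoning setoid public

    -- Morphisms are tested on points over every extension, so the coefficient laws are carried
    -- along `ι` and the identities of `CurveChange` are applied over `L`.
    ι-change : ∀ {E E′} → CK.ChangeOfVariables E E′ → ChangeOfVariables (ι-curve E) (ι-curve E′)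
    ι-change S = record
      { u = ι (u S) ; v = ι (v S) ; r = ι (r S)
      ; u*v≈1  = trans (sym (*-homo _ _)) (trans (⟦⟧-cong (u*v≈1 S)) 1#-homo)
      ; a₄-law = trans (sym (trans (*-homo _ _) (*-congʳ (ι-^ (u S) 4)))) (⟦⟧-cong (a₄-law S))
      ; a₆-law = trans (sym (trans (*-homo _ _) (*-congʳ (ι-^ (u S) 6))))
                   (trans (⟦⟧-cong (a₆-law S)) (trans (+-homo _ _) (+-congʳ
                     (trans (+-homo _ _) (+-cong (ι-^ (r S) 3) (*-homo _ _))))))
      }

  linearForms : ∀ {E E′} → CK.ChangeOfVariables E E′ → Fin 3 → Form K 1
  linearForms S 0F = term (u S K.^ 2) 1 0 0 ≡.refl ∷ term (r S) 0 0 1 ≡.refl ∷ []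
  linearForms S 1F = term (u S K.^ 3) 0 1 0 ≡.refl ∷ []
  linearForms S 2F = term K.1# 0 0 1 ≡.refl ∷ []

  module Evaluation {E E′} (S : CK.ChangeOfVariables E E′) (X : Extension K) where
    open Over X
    open Plane L

    U R : Carrier
    U = ι (u S)
    R = ι (r S)

    eval-x : ∀ (P : Coords) → eval X (linearForms S 0F) P ≈ U ↑ 2 * P 0F + R * P 2F
    eval-x P = begin
      ι (u S K.^ 2) * monomial 1 0 0 P + (R * monomial 0 0 1 P + 0#)
        ≈⟨ +-cong (*-cong (ι-^ (u S) 2) (monomial-x P)) (trans (+-identityʳ _) (*-congˡ (monomial-z P))) ⟩
      U ↑ 2 * P 0F + R * P 2F ∎

    eval-y : ∀ (P : Coords) → eval X (linearForms S 1F) P ≈ U ↑ 3 * P 1F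
    eval-y P = begin
      ι (u S K.^ 3) * monomial 0 1 0 P + 0#
        ≈⟨ trans (+-identityʳ _) (*-cong (ι-^ (u S) 3) (monomial-y P)) ⟩
      U ↑ 3 * P 1F ∎

    eval-z : ∀ (P : Coords) → eval X (linearForms S 2F) P ≈ P 2F
    eval-z P = begin
      ι K.1# * monomial 0 0 1 P + 0# ≈⟨ trans (+-identityʳ _) (*-cong 1#-homo (monomial-z P)) ⟩
      1# * P 2F                      ≈⟨ *-identityˡ (P 2F) ⟩
      P 2F                           ∎

    U#0 : U # 0#
    U#0 = unit⇒#0 (trans (sym (*-homo _ _)) (trans (⟦⟧-cong (u*v≈1 S)) 1#-homo))

    nonZero : ∀ (P : Coords) → NonZero P → NonZero (λ i → eval X (linearForms S i) P)
    nonZero P (2F , z#0) = 2F , #-congʳ (sym (eval-z P)) z#0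
    nonZero P (1F , y#0) = 1F , #-congʳ (sym (eval-y P)) (x#0y#0→xy#0 (^-#0 3 U#0) y#0)
    -- The new first coordinate is U²x + Rz with U²x apart from zero, so either it or Rz is apart
    -- from zero; in the latter case z is.
    nonZero P (0F , x#0) =
      [ (λ x′#0 → 0F , #-congʳ (sym (eval-x P)) x′#0)
      , (λ Rz#0 → 2F , #-congʳ (sym (eval-z P)) (x*y#0⇒y#0 Rz#0))
      ] (x#0⇒x+y#0⊎y#0 {y = R * P 2F} (x#0y#0→xy#0 (^-#0 2 U#0) x#0))

    onCurve : ∀ (P : Coords) → OnCurve X E′ P → OnCurve X E (λ i → eval X (linearForms S i) P)
    onCurve P P∈E′ = begin
      y ↑ 2 * z ≈⟨ *-congˡ z≈ ⟩
      y ↑ 2 * P 2F ≈⟨ homogeneous-law (ι-change S) (eval-x P) (eval-y P) P∈E′ ⟩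
      x ↑ 3 + ι E.a₄ * (x * P 2F ↑ 2) + ι E.a₆ * P 2F ↑ 3
        ≈⟨ +-cong (+-congˡ (*-congˡ (*-congˡ (^-congˡ 2 z≈)))) (*-congˡ (^-congˡ 3 z≈)) ⟨
      x ↑ 3 + ι E.a₄ * (x * z ↑ 2) + ι E.a₆ * z ↑ 3 ∎
      where
      module E = Weierstrass E
      x y z : Carrier
      x = eval X (linearForms S 0F) P
      y = eval X (linearForms S 1F) P
      z = eval X (linearForms S 2F) P
      z≈ : z ≈ P 2F
      z≈ = eval-z P

    -- When X and Z vanish only the form u³Y survives, so u³ is the factor of proportionality.
    fixes-infinity : ∀ (P : Coords) → P 0F ≈ 0# → P 2F ≈ 0# → (λ i → eval X (linearForms S i) P) ∼ P
    fixes-infinity P x≈0 z≈0 = U ↑ 3 , ^-#0 3 U#0 , scaled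
      where
      multiple-0 : ∀ a {b} → b ≈ 0# → a * b ≈ 0#
      multiple-0 a b≈0 = trans (*-congˡ b≈0) (zeroʳ a)

      scaled : ∀ i → eval X (linearForms S i) P ≈ U ↑ 3 * P i
      scaled 0F = begin
        eval X (linearForms S 0F) P ≈⟨ eval-x P ⟩
        U ↑ 2 * P 0F + R * P 2F     ≈⟨ +-cong (multiple-0 (U ↑ 2) x≈0) (multiple-0 R z≈0) ⟩
        0# + 0#                     ≈⟨ +-identityˡ 0# ⟩
        0#                          ≈⟨ multiple-0 (U ↑ 3) x≈0 ⟨
        U ↑ 3 * P 0F                ∎
      scaled 1F = eval-y P
      scaled 2F = begin
        eval X (linearForms S 2F) P ≈⟨ eval-z P ⟩
        P 2F                        ≈⟨ z≈0 ⟩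
        0#                          ≈⟨ multiple-0 (U ↑ 3) z≈0 ⟨
        U ↑ 3 * P 2F                ∎

  -- The direction is reversed because the substitution expresses the coordinates on `E` by those on
  -- `E′`. A single triple of linear forms suffices, as it vanishes at no point.
  linearMorphism : ∀ {E E′} → CK.ChangeOfVariables E E′ → Morphism E′ E
  linearMorphism {E} {E′} S = record
    { size     = 1
    ; degree   = λ _ → 1
    ; forms    = λ _ → linearForms S
    ; regular  = λ X P → 0F , Evaluation.nonZero S X (Point.coords P) (Point.nonZero P)
    ; image    = λ { X P 0F _ → Evaluation.onCurve S X (Point.coords P) (Point.onCurve P) }
    ; coherent = λ { X P 0F 0F _ _ → coherent₀ X }
    }
    where
    coherent₀ : ∀ X {P} → Plane._∼_ (Extension.L X) P P
    coherent₀ X = 1# , 1#0 , λ i → sym (*-identityˡ _)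
      where open Over X

  module Composite {E E′} (S : CK.ChangeOfVariables E E′) (T : CK.ChangeOfVariables E′ E)
                   (X : Extension K) where
    open Over X
    open Plane L
    open SemiringSolver commutativeSemiring using (solve; _:=_; _:+_; _:*_)
    private
      module S = Evaluation S X
      module T = Evaluation T X

    -- The composite sends x to (UU′)²x + (U²R′ + R)z and y to (UU′)³y. The two hypotheses make it
    -- the identity on coordinates, so the factor of proportionality is 1.
    composite≈id : u S K.* u T K.≈ K.1# → S.U ↑ 2 * T.R + S.R ≈ 0# → (P : Coords) →
                   (λ i → eval X (linearForms S i) (λ j → eval X (linearForms T j) P)) ∼ P
    composite≈id uu′≈1 UR′+R≈0 P = 1# , 1#0 , λ i → trans (fixed i) (sym (*-identityˡ (P i)))
      where
      Q : Coords
      Q j = eval X (linearForms T j) P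

      UU′≈1 : S.U * T.U ≈ 1#
      UU′≈1 = trans (sym (*-homo _ _)) (trans (⟦⟧-cong uu′≈1) 1#-homo)

      fixed : ∀ i → eval X (linearForms S i) Q ≈ P i
      fixed 0F = begin
        eval X (linearForms S 0F) Q
          ≈⟨ S.eval-x Q ⟩
        S.U ↑ 2 * Q 0F + S.R * Q 2F
          ≈⟨ +-cong (*-congˡ (T.eval-x P)) (*-congˡ (T.eval-z P)) ⟩
        S.U ↑ 2 * (T.U ↑ 2 * P 0F + T.R * P 2F) + S.R * P 2F
          ≈⟨ solve 6 (λ a b r s x z → a :* (b :* x :+ s :* z) :+ r :* z :=
                                      a :* (b :* x) :+ (a :* s :+ r) :* z)
               refl (S.U ↑ 2) (T.U ↑ 2) S.R T.R (P 0F) (P 2F) ⟩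
        S.U ↑ 2 * (T.U ↑ 2 * P 0F) + (S.U ↑ 2 * T.R + S.R) * P 2F
          ≈⟨ +-cong (u^n*[v^n*x]≈x 2 (P 0F) UU′≈1) (trans (*-congʳ UR′+R≈0) (zeroˡ _)) ⟩
        P 0F + 0#
          ≈⟨ +-identityʳ _ ⟩
        P 0F ∎
      fixed 1F = begin
        eval X (linearForms S 1F) Q     ≈⟨ S.eval-y Q ⟩
        S.U ↑ 3 * Q 1F                  ≈⟨ *-congˡ (T.eval-y P) ⟩
        S.U ↑ 3 * (T.U ↑ 3 * P 1F)      ≈⟨ u^n*[v^n*x]≈x 3 (P 1F) UU′≈1 ⟩
        P 1F                            ∎
      fixed 2F = trans (S.eval-z Q) (T.eval-z P)

  module Flip {E E′} (S : CK.ChangeOfVariables E E′) (X : Extension K) where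
    open Over X
    private
      T : CK.ChangeOfVariables E′ E
      T = CK.flip S
      module S = Evaluation S X
      module T = Evaluation T X

    -- This is the image under `ι` of the definition of the translation in `flip` as -v²r.
    V²R+R′≈0 : T.U ↑ 2 * S.R + T.R ≈ 0#
    V²R+R′≈0 = begin
      T.U ↑ 2 * S.R + T.R         ≈⟨ +-congʳ (*-congʳ (ι-^ (v S) 2)) ⟨
      ι (v S K.^ 2) * S.R + T.R   ≈⟨ +-congʳ (*-homo _ _) ⟨
      ι (v S K.^ 2 K.* r S) + T.R ≈⟨ +-homo _ _ ⟨
      ι (v S K.^ 2 K.* r S K.+ r T) ≈⟨ ⟦⟧-cong (K.-‿inverseʳ _) ⟩
      ι K.0#                      ≈⟨ 0#-homo ⟩
      0#                          ∎

    -- This is U² times `V²R+R′≈0`, since U²V² = 1; it is the translation part of the composite in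
    -- the other order.
    U²R′+R≈0 : S.U ↑ 2 * T.R + S.R ≈ 0#
    U²R′+R≈0 = begin
      S.U ↑ 2 * T.R + S.R
        ≈⟨ +-congˡ (u^n*[v^n*x]≈x 2 S.R (ChangeOfVariables.u*v≈1 (ι-change S))) ⟨
      S.U ↑ 2 * T.R + S.U ↑ 2 * (T.U ↑ 2 * S.R)
        ≈⟨ distribˡ (S.U ↑ 2) _ _ ⟨
      S.U ↑ 2 * (T.R + T.U ↑ 2 * S.R)
        ≈⟨ *-congˡ (trans (+-comm _ _) V²R+R′≈0) ⟩
      S.U ↑ 2 * 0#
        ≈⟨ zeroʳ _ ⟩
      0# ∎

  change⇒≅ : ∀ {E E′} → CK.ChangeOfVariables E E′ → E ≅ E′
  change⇒≅ {E} {E′} S = record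
    -- A substitution induces a morphism against its own direction, so the map out of `E` comes from
    -- the inverse substitution.
    { to      = linearMorphism T
    ; from    = linearMorphism S
    ; from∘to = λ X P → Composite.composite≈id S T X (u*v≈1 S) (Flip.U²R′+R≈0 S X) (Point.coords P)
    ; to∘from = λ X P → Composite.composite≈id T S X (u*v≈1 T) (Flip.V²R+R′≈0 S X) (Point.coords P)
    ; to-𝒪    = fixes-𝒪
    }
    where
    T : CK.ChangeOfVariables E′ E
    T = CK.flip S

    fixes-𝒪 : ∀ X → _≃_ X (Morphism.apply (linearMorphism T) X (𝒪 X)) (𝒪 X)
    fixes-𝒪 X = Evaluation.fixes-infinity T X O refl refl
      where
      open HeytingField (Extension.L X) using (refl)

      O : Plane.Coords (Extension.L X)
      O = Point.coords (𝒪 X {E})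

-- Curves of Type I⁺ when d is odd.

module OddDegree {c ℓ₁ ℓ₂} (K : HeytingField c ℓ₁ ℓ₂) (d : ℕ) (odd : d % 2 ≡ 1)
                 (card : HasCardinality K (3 ^ d)) where
  open CardinalityPowerOf3 K d card public using (char3; r³+r+b-root)
  open Field K using (_*_) renaming (_^_ to infixl 8 _↑_)
  open CurveChange K char3 public

  TypeI⁺⇒change : ∀ E → TypeI⁺ E → ChangeOfVariables E (y²=x³+x K)
  TypeI⁺⇒change (weierstrass a₄ a₆) (_ , u , u#0 , a₄≈u⁴) =
    reduction a₄≈u⁴ (proj₂ inverse) (proj₂ (root (proj₁ inverse)))
    where
    inverse = FieldProperties.#0⇒unit K u#0
    -- The constant b of the cubic is a₆/u⁶, with `v` the inverse of `u`.
    root = λ v → r³+r+b-root odd (v ↑ 6 * a₆)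

mainTheorem2 : ∀ {c ℓ₁ ℓ₂} (K : HeytingField c ℓ₁ ℓ₂) (d : ℕ) →
    d % 2 ≡ 1 → HasCardinality K (3 ^ d) →
    (∀ (E : Weierstrass K) → IsElliptic E → TypeI⁺ E → E ≅ y²=x³+x K)
    × (∀ (E E′ : Weierstrass K) → IsElliptic E → TypeI⁺ E →
    IsElliptic E′ → TypeI⁺ E′ → E ≅ E′)
mainTheorem2 K d odd card =
  (λ E _ E-I⁺ → change⇒≅ char3 (TypeI⁺⇒change E E-I⁺)) ,
  (λ E E′ _ E-I⁺ _ E′-I⁺ →
    -- Both curves reduce to y² = x³ + x, so the reduction of `E` is followed by the inverse of that
    -- of `E′`.
    change⇒≅ char3 (compose (TypeI⁺⇒change E E-I⁺) (flip (TypeI⁺⇒change E′ E′-I⁺))))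
  where open OddDegree K d odd card
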